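{- Let $P$, $Q$, and $R$ be problems. Then $R$ is computably reducible to $Q$ followed by $P$ if and only if $R \leq_c P *_c Q$.
   Context: A problem $P : \subseteq \omega^\omega \rightrightarrows \omega^\omega$ is a partial multi-function taking $\omega$-valued sequences to sets of $\omega$-valued sequences: it has a domain $\mathrm{dom}(P) \subseteq \omega^\omega$, whose elements are called the instances of $P$ (or $P$-instances), and to each $X \in \mathrm{dom}(P)$ it assigns a set $P(X) \subseteq \omega^\omega$, whose elements are called the $P$-solutions of $X$. Write $\leq_T$ for Turing reducibility and $\oplus$ for the Turing join. Computable reducibility: for problems $P$ and $Q$, $P \leq_c Q$ means that for every $X \in \mathrm{dom}(P)$ there is $\widehat{X} \in \mathrm{dom}(Q)$ with $\widehat{X} \leq_T X$ such that for every $\widehat{Y} \in Q(\widehat{X})$ there is $Y \in P(X)$ with $Y \leq_T X \oplus \widehat{Y}$. For problems $P$, $Q$, $R$, we say that $R$ is computably reducible to $Q$ followed by $P$ if for every $R$-instance $X$ there is a $Q$-instance $\widehat{X} \leq_T X$ such that for every $Q$-solution $\widehat{Y}$ of $\widehat{X}$ there is a $P$-instance $Z \leq_T X \oplus \widehat{Y}$ such that for every $P$-solution $W$ of $Z$ there is an $R$-solution $Y$ of $X$ with $Y \leq_T X \oplus \widehat{Y} \oplus W$. Composition: for problems $P$ and $Q$, $P \circ Q$ is the problem whose instances are those $X \in \mathrm{dom}(Q)$ such that every $Y \in Q(X)$ satisfies $Y \in \mathrm{dom}(P)$; the $(P \circ Q)$-solutions of such an $X$ are all $Z$ such that there exists $Y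 \in Q(X)$ with $Z \in P(Y)$. For problems $P$ and $Q$, $P *_c Q$ denotes the collection of compositions $P *_c Q = \{P' \circ Q' : P' \leq_c P \text{ and } Q' \leq_c Q\}$, where $P'$ and $Q'$ range over problems. For a problem $R$, $R \leq_c P *_c Q$ means that there is $(P' \circ Q') \in P *_c Q$ such that $R \leq_c P' \circ Q'$. -}

module Defs where

open import Data.Bool.Base using (if_then_else_)
open import Data.Fin.Base using (Fin)
open import Data.Nat.Base using (ℕ; zero; suc; _<_; _≡ᵇ_; _/_; _%_)
open import Data.Product.Base using (_×_; _,_; ∃-syntax; proj₁; proj₂)
open import Data.Vec.Base using (Vec; []; _∷_; lookup)
open import Data.Vec.Relation.Binary.Pointwise.Inductive using (Pointwise)
open import Level using (0ℓ) renaming (suc to lsuc)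
open import Relation.Binary.Core using (Rel)
open import Relation.Binary.Definitions using (_Respects_; _Respects₂_)
open import Relation.Binary.PropositionalEquality.Core using (_≡_; _≗_; sym)
open import Relation.Unary using (Pred; _∈_)

infixl 6 _⊕_
infix 4 _≤T_ _≤c_ _≤c∗_
infixr 7 _∘ₚ_ _*c_

Seq : Set
Seq = ℕ → ℕ

-- Turing reducibility is defined by Kleene's partial recursive functions
-- relative to an oracle; Code n are the programs with n arguments.
data Code : ℕ → Set where
  zero   : Code 0
  suc    : Code 1
  oracle : Code 1
  proj   : ∀ {n} → Fin n → Code n
  comp   : ∀ {m n} → Code m → Vec (Code n) m → Code n
  prec   : ∀ {n} → Code n → Code (suc (suc n)) → Code (suc n)
  min    : ∀ {n} → Code (suc n) → Code n

-- A ⊢ e [ xs ]⇓ y : the program e with oracle A halts on xs with output y.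
data _⊢_[_]⇓_ (A : Seq) : ∀ {n} → Code n → Vec ℕ n → ℕ → Set where
  zero⇓   : A ⊢ zero [ [] ]⇓ 0
  suc⇓    : ∀ {x} → A ⊢ suc [ x ∷ [] ]⇓ suc x
  oracle⇓ : ∀ {x} → A ⊢ oracle [ x ∷ [] ]⇓ A x
  proj⇓   : ∀ {n} {i : Fin n} {xs} → A ⊢ proj i [ xs ]⇓ lookup xs i
  comp⇓   : ∀ {m n} {h : Code m} {gs : Vec (Code n) m} {xs ys z} →
            Pointwise (λ g y → A ⊢ g [ xs ]⇓ y) gs ys →
            A ⊢ h [ ys ]⇓ z →
            A ⊢ comp h gs [ xs ]⇓ z
  prec⇓0  : ∀ {n} {g : Code n} {h xs y} →
            A ⊢ g [ xs ]⇓ y →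
            A ⊢ prec g h [ 0 ∷ xs ]⇓ y
  prec⇓+  : ∀ {n} {g : Code n} {h xs k y z} →
            A ⊢ prec g h [ k ∷ xs ]⇓ y →
            A ⊢ h [ k ∷ y ∷ xs ]⇓ z →
            A ⊢ prec g h [ suc k ∷ xs ]⇓ z
  min⇓    : ∀ {n} {g : Code (suc n)} {xs k} →
            A ⊢ g [ k ∷ xs ]⇓ 0 →
            (∀ {j} → j < k → ∃[ y ] A ⊢ g [ j ∷ xs ]⇓ suc y) →
            A ⊢ min g [ xs ]⇓ k

_≤T_ : Rel Seq 0ℓ
X ≤T A = ∃[ e ] (∀ n → A ⊢ e [ n ∷ [] ]⇓ X n)

_⊕_ : Seq → Seq → Seq
(X ⊕ Y) n = if n % 2 ≡ᵇ 0 then X (n / 2) else Y (n / 2)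

-- Sequences are equal when they agree pointwise, so a subset of ω^ω is a
-- predicate respecting _≗_.  The set P(X) is sol X; it is only meaningful for
-- X ∈ dom, and every notion below consults it only there.
record Problem : Set₁ where
  field
    dom      : Pred Seq 0ℓ
    sol      : Seq → Pred Seq 0ℓ
    dom-resp : dom Respects _≗_
    sol-resp : sol Respects₂ _≗_

open Problem public

_≤c_ : Rel Problem 0ℓ
P ≤c Q =
  ∀ X → X ∈ dom P →
  ∃[ X̂ ] X̂ ∈ dom Q × X̂ ≤T X ×
  (∀ Ŷ → Ŷ ∈ sol Q X̂ →
   ∃[ Y ] Y ∈ sol P X × Y ≤T X ⊕ Ŷ)

_ComputablyReducibleTo_FollowedBy_ : Problem → Problem → Problem → Set
R ComputablyReducibleTo Q FollowedBy P =
  ∀ X → X ∈ dom R →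
  ∃[ X̂ ] X̂ ∈ dom Q × X̂ ≤T X ×
  (∀ Ŷ → Ŷ ∈ sol Q X̂ →
   ∃[ Z ] Z ∈ dom P × Z ≤T X ⊕ Ŷ ×
   (∀ W → W ∈ sol P Z →
    ∃[ Y ] Y ∈ sol R X × Y ≤T X ⊕ Ŷ ⊕ W))

_∘ₚ_ : Problem → Problem → Problem
P ∘ₚ Q = record
  { dom      = λ X → X ∈ dom Q × (∀ Y → Y ∈ sol Q X → Y ∈ dom P)
  ; sol      = λ X Z → ∃[ Y ] Y ∈ sol Q X × Z ∈ sol P Y
  ; dom-resp = λ X≗X′ (X∈Q , Q⊆P) →
      dom-resp Q X≗X′ X∈Q ,
      λ Y Y∈Q → Q⊆P Y (proj₂ (sol-resp Q) (λ n → sym (X≗X′ n)) Y∈Q)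
  ; sol-resp =
      (λ Z≗Z′ (Y , Y∈Q , Z∈P) → Y , Y∈Q , proj₁ (sol-resp P) Z≗Z′ Z∈P) ,
      (λ X≗X′ (Y , Y∈Q , Z∈P) → Y , proj₂ (sol-resp Q) X≗X′ Y∈Q , Z∈P)
  }

_*c_ : Problem → Problem → Pred Problem (lsuc 0ℓ)
(P *c Q) S = ∃[ P′ ] ∃[ Q′ ] P′ ≤c P × Q′ ≤c Q × S ≡ P′ ∘ₚ Q′

_≤c∗_ : Problem → Pred Problem (lsuc 0ℓ) → Set₁
R ≤c∗ 𝒞 = ∃[ S ] S ∈ 𝒞 × R ≤c S

{-# OPTIONS --safe #-}

-- From right to left the reductions are chained.  From left to right, an
-- instance of Q⁺ is a join X ⊕ X̂, where X̂ is a Q-instance witnessing the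
-- hypothesis for X, and its Q⁺-solutions are the joins X ⊕ Ŷ ⊕ Z, where Ŷ is a
-- Q-solution of X̂ and Z is a P-instance witnessing the hypothesis for Ŷ; then
-- P⁺ maps C ⊕ Z to the joins C ⊕ Z ⊕ W with W a P-solution of Z.  Carrying the
-- witnesses along makes P⁺ and Q⁺ well defined without any choice of X̂ from X
-- or of Z from Ŷ.
module Submission where

open import Data.Bool.Base using (if_then_else_)
open import Data.Fin.Base using (zero; suc)
open import Data.Nat.Base using (ℕ; zero; suc; _*_; _≡ᵇ_; _/_; _%_)
open import Data.Nat.Divisibility using (∣-refl; n∣m*n)
open import Data.Nat.DivMod using (+-distrib-/-∣ˡ; +-distrib-/-∣ʳ; m*n/n≡m; m*n%n≡0; [m+kn]%n≡m%n)
open import Data.Product.Base using (_×_; _,_; ∃-syntax; proj₁; proj₂)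
open import Data.Vec.Base using (Vec; []; _∷_)
open import Data.Vec.Relation.Binary.Pointwise.Inductive using (Pointwise; []; _∷_)
open import Function.Base using (_∘_)
open import Function.Bundles using (_⇔_; mk⇔)
open import Relation.Binary.PropositionalEquality
open import Relation.Unary using (_∈_)
open import Defs

private variable
  A B C X Y : Seq

-- Turing reducibility as a preorder.

mutual
  -- Answering each oracle call by running `a` composes two reductions into one program.
  substOracle : Code 1 → ∀ {n} → Code n → Code n
  substOracle a zero        = zero
  substOracle a suc         = suc
  substOracle a oracle      = a
  substOracle a (proj i)    = proj i
  substOracle a (comp h gs) = comp (substOracle a h) (substOracles a gs)
  substOracle a (prec g h)  = prec (substOracle a g) (substOracle a h)
  substOracle a (min g)     = min (substOracle a g)

  substOracles : Code 1 → ∀ {m n} → Vec (Code n) m → Vec (Code n) m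
  substOracles a []       = []
  substOracles a (g ∷ gs) = substOracle a g ∷ substOracles a gs

module _ {a : Code 1} (a⇓ : ∀ n → B ⊢ a [ n ∷ [] ]⇓ A n) where
  mutual
    substOracle⇓ : ∀ {n} {e : Code n} {xs y} →
                   A ⊢ e [ xs ]⇓ y → B ⊢ substOracle a e [ xs ]⇓ y
    substOracle⇓ zero⇓         = zero⇓
    substOracle⇓ suc⇓          = suc⇓
    substOracle⇓ oracle⇓       = a⇓ _
    substOracle⇓ proj⇓         = proj⇓
    substOracle⇓ (comp⇓ gs h)  = comp⇓ (substOracles⇓ gs) (substOracle⇓ h)
    substOracle⇓ (prec⇓0 g)    = prec⇓0 (substOracle⇓ g)
    substOracle⇓ (prec⇓+ r h)  = prec⇓+ (substOracle⇓ r) (substOracle⇓ h)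
    substOracle⇓ (min⇓ g below) = min⇓ (substOracle⇓ g) λ j<k →
      proj₁ (below j<k) , substOracle⇓ (proj₂ (below j<k))

    substOracles⇓ : ∀ {m n} {gs : Vec (Code n) m} {xs ys} →
                    Pointwise (λ g y → A ⊢ g [ xs ]⇓ y) gs ys →
                    Pointwise (λ g y → B ⊢ g [ xs ]⇓ y) (substOracles a gs) ys
    substOracles⇓ []       = []
    substOracles⇓ (g ∷ gs) = substOracle⇓ g ∷ substOracles⇓ gs

≤T-trans : X ≤T A → A ≤T B → X ≤T B
≤T-trans (e , e⇓) (a , a⇓) = substOracle a e , λ n → substOracle⇓ a⇓ (e⇓ n)

≤T-respˡ : X ≗ Y → X ≤T A → Y ≤T A
≤T-respˡ {A = A} X≗Y (e , e⇓) = e , λ n → subst (A ⊢ e [ n ∷ [] ]⇓_) (X≗Y n) (e⇓ n)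

≤T-reflexive : X ≗ Y → Y ≤T X
≤T-reflexive X≗Y = ≤T-respˡ X≗Y (oracle , λ _ → oracle⇓)

≤T-refl : X ≤T X
≤T-refl = ≤T-reflexive λ _ → refl

-- Sequences computable by composition, branching and recursion.

≤T-∘ : X ≤T A → Y ≤T A → X ∘ Y ≤T A
≤T-∘ (x , x⇓) (y , y⇓) = comp x (y ∷ []) , λ n → comp⇓ (y⇓ n ∷ []) (x⇓ _)

suc-≤T : suc ≤T A
suc-≤T = suc , λ _ → suc⇓

-- Primitive recursion serves as case distinction: the base case returns the second argument, and
-- each successor step discards the recursive value and returns the third.
branch : Code 3
branch = prec (proj zero) (proj (suc (suc (suc zero))))

branch⇓ : ∀ c x y → A ⊢ branch [ c ∷ x ∷ y ∷ [] ]⇓ (if c ≡ᵇ 0 then x else y)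
branch⇓ zero    x y = prec⇓0 proj⇓
branch⇓ (suc c) x y = prec⇓+ (branch⇓ c x y) proj⇓

≤T-branch : C ≤T A → X ≤T A → Y ≤T A →
            (λ n → if C n ≡ᵇ 0 then X n else Y n) ≤T A
≤T-branch (c , c⇓) (x , x⇓) (y , y⇓) =
  comp branch (c ∷ x ∷ y ∷ []) ,
  λ n → comp⇓ (c⇓ n ∷ x⇓ n ∷ y⇓ n ∷ []) (branch⇓ _ _ _)

≤T-rec : (h : Code 2) → X 0 ≡ 0 →
         (∀ k → A ⊢ h [ k ∷ X k ∷ [] ]⇓ X (suc k)) → X ≤T A
≤T-rec {X} {A} h X0≡0 h⇓ = prec zero h , go
  where
  go : ∀ n → A ⊢ prec zero h [ n ∷ [] ]⇓ X n
  go zero    = prec⇓0 (subst (A ⊢ zero [ [] ]⇓_) (sym X0≡0) zero⇓)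
  go (suc k) = prec⇓+ (go k) (h⇓ k)

double-≤T : (_* 2) ≤T A
double-≤T = ≤T-rec (comp suc (comp suc (proj (suc zero) ∷ []) ∷ [])) refl
  λ k → comp⇓ (comp⇓ (proj⇓ ∷ []) suc⇓ ∷ []) suc⇓

suc-%2 : ∀ n → suc n % 2 ≡ (if n % 2 ≡ᵇ 0 then 1 else 0)
suc-%2 0             = refl
suc-%2 1             = refl
suc-%2 (suc (suc n)) = suc-%2 n

-- Division runs with an accumulator, so unlike the remainder the quotient does not reduce on two
-- successors by computation alone.
2+n/2 : ∀ n → suc (suc n) / 2 ≡ suc (n / 2)
2+n/2 n = +-distrib-/-∣ˡ {2} n ∣-refl

-- The quotient grows exactly when passing from an odd number to its successor, so a recursion for
-- it needs only the parity and the previous value.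
suc-/2 : ∀ n → suc n / 2 ≡ (if n % 2 ≡ᵇ 0 then n / 2 else suc (n / 2))
suc-/2 0             = refl
suc-/2 1             = refl
suc-/2 (suc (suc n)) rewrite 2+n/2 (suc n) | 2+n/2 n | suc-/2 n with n % 2
... | zero  = refl
... | suc _ = refl

parity-≤T : (_% 2) ≤T A
parity-≤T {A} = ≤T-rec h refl λ k → subst (A ⊢ h [ k ∷ k % 2 ∷ [] ]⇓_) (sym (suc-%2 k))
  (comp⇓ (proj⇓ ∷ comp⇓ (comp⇓ [] zero⇓ ∷ []) suc⇓ ∷ comp⇓ [] zero⇓ ∷ []) (branch⇓ _ _ _))
  where
  0ᶜ : Code 2
  0ᶜ = comp zero []
  h : Code 2
  h = comp branch (proj (suc zero) ∷ comp suc (0ᶜ ∷ []) ∷ 0ᶜ ∷ [])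

half-≤T : (_/ 2) ≤T A
half-≤T {A} = ≤T-rec h refl λ k → subst (A ⊢ h [ k ∷ k / 2 ∷ [] ]⇓_) (sym (suc-/2 k))
  (comp⇓ (comp⇓ (proj⇓ ∷ []) (proj₂ parity k) ∷ proj⇓ ∷ comp⇓ (proj⇓ ∷ []) suc⇓ ∷ [])
         (branch⇓ _ _ _))
  where
  parity : (_% 2) ≤T A
  parity = parity-≤T
  h : Code 2
  h = comp branch ( comp (proj₁ parity) (proj zero ∷ [])
                  ∷ proj (suc zero)
                  ∷ comp suc (proj (suc zero) ∷ [])
                  ∷ [])

-- The join as a least upper bound.

⊕-even : ∀ X Y n → (X ⊕ Y) (n * 2) ≡ X n
⊕-even X Y n rewrite m*n%n≡0 n 2 ⦃ _ ⦄ | m*n/n≡m n 2 ⦃ _ ⦄ = refl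

⊕-odd : ∀ X Y n → (X ⊕ Y) (suc (n * 2)) ≡ Y n
⊕-odd X Y n
  rewrite [m+kn]%n≡m%n 1 n 2 ⦃ _ ⦄ | +-distrib-/-∣ʳ 1 {n * 2} {2} (n∣m*n n) | m*n/n≡m n 2 ⦃ _ ⦄ = refl

-- The left component can be read back at the even places. This serves to compare two splittings of
-- one sequence.
⊕-injectiveˡ : ∀ X Y X′ Y′ → X ⊕ Y ≗ X′ ⊕ Y′ → X ≗ X′
⊕-injectiveˡ X Y X′ Y′ eq n =
  trans (sym (⊕-even X Y n)) (trans (eq (n * 2)) (⊕-even X′ Y′ n))

⊕-injectiveʳ : ∀ X Y X′ Y′ → X ⊕ Y ≗ X′ ⊕ Y′ → Y ≗ Y′
⊕-injectiveʳ X Y X′ Y′ eq n =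
  trans (sym (⊕-odd X Y n)) (trans (eq (suc (n * 2))) (⊕-odd X′ Y′ n))

≤T-⊕ˡ : ∀ X Y → X ≤T X ⊕ Y
≤T-⊕ˡ X Y = ≤T-respˡ (⊕-even X Y) (≤T-∘ ≤T-refl double-≤T)

≤T-⊕ʳ : ∀ X Y → Y ≤T X ⊕ Y
≤T-⊕ʳ X Y = ≤T-respˡ (⊕-odd X Y) (≤T-∘ ≤T-refl (≤T-∘ suc-≤T double-≤T))

⊕-lub : X ≤T A → Y ≤T A → X ⊕ Y ≤T A
⊕-lub X≤A Y≤A = ≤T-branch parity-≤T (≤T-∘ X≤A half-≤T) (≤T-∘ Y≤A half-≤T)

⊕-monoˡ : ∀ Y → X ≤T A → X ⊕ Y ≤T A ⊕ Y
⊕-monoˡ {A = A} Y X≤A = ⊕-lub (≤T-trans X≤A (≤T-⊕ˡ A Y)) (≤T-⊕ʳ A Y)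

-- The two directions of the equivalence.

module _ (P Q R : Problem) where

  followedBy⇐ : R ≤c∗ (P *c Q) → R ComputablyReducibleTo Q FollowedBy P
  followedBy⇐ (_ , (P′ , Q′ , P′≤P , Q′≤Q , refl) , R≤P′∘Q′) X X∈R =
    let X₁ , (X₁∈Q′ , Q′⊆P′) , X₁≤X , back   = R≤P′∘Q′ X X∈R
        X̂ , X̂∈Q , X̂≤X₁ , backQ              = Q′≤Q X₁ X₁∈Q′
    in X̂ , X̂∈Q , ≤T-trans X̂≤X₁ X₁≤X , λ Ŷ Ŷ∈Q →
    let Y₁ , Y₁∈Q′ , Y₁≤X₁⊕Ŷ                  = backQ Ŷ Ŷ∈Q
        -- The domain of the composition makes `Y₁`, a `Q′`-solution of `X₁`, a `P′`-instance.
        Z , Z∈P , Z≤Y₁ , backP                = P′≤P Y₁ (Q′⊆P′ Y₁ Y₁∈Q′)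
        Y₁≤X⊕Ŷ                                = ≤T-trans Y₁≤X₁⊕Ŷ (⊕-monoˡ Ŷ X₁≤X)
    in Z , Z∈P , ≤T-trans Z≤Y₁ Y₁≤X⊕Ŷ , λ W W∈P →
    let V , V∈P′ , V≤Y₁⊕W                     = backP W W∈P
        Y , Y∈R , Y≤X⊕V                       = back V (Y₁ , Y₁∈Q′ , V∈P′)
    in Y , Y∈R , ≤T-trans Y≤X⊕V (⊕-lub (≤T-trans (≤T-⊕ˡ X Ŷ) (≤T-⊕ˡ (X ⊕ Ŷ) W))
                                        (≤T-trans V≤Y₁⊕W (⊕-monoˡ W Y₁≤X⊕Ŷ)))

  -- Isolates the conditions on a witness `Z`, so that `Q⁺` can demand them of its instances and
  -- also record them in its solutions.
  Continues : Seq → Seq → Seq → Set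
  Continues X Ŷ Z =
    Z ∈ dom P × Z ≤T X ⊕ Ŷ ×
    (∀ W → W ∈ sol P Z → ∃[ Y ] Y ∈ sol R X × Y ≤T X ⊕ Ŷ ⊕ W)

  Q⁺ : Problem
  Q⁺ = record
    { dom = λ A → ∃[ X ] ∃[ X̂ ] A ≗ X ⊕ X̂ × X̂ ∈ dom Q ×
                  (∀ Ŷ → Ŷ ∈ sol Q X̂ → ∃[ Z ] Continues X Ŷ Z)
    ; sol = λ A B → ∃[ X ] ∃[ X̂ ] ∃[ Ŷ ] ∃[ Z ] A ≗ X ⊕ X̂ × B ≗ X ⊕ Ŷ ⊕ Z ×
                    Ŷ ∈ sol Q X̂ × Continues X Ŷ Z
    ; dom-resp = λ A≗A′ (X , X̂ , A≗ , rest) →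
        X , X̂ , (λ n → trans (sym (A≗A′ n)) (A≗ n)) , rest
    ; sol-resp =
        (λ B≗B′ (X , X̂ , Ŷ , Z , A≗ , B≗ , rest) →
          X , X̂ , Ŷ , Z , A≗ , (λ n → trans (sym (B≗B′ n)) (B≗ n)) , rest) ,
        (λ A≗A′ (X , X̂ , Ŷ , Z , A≗ , rest) →
          X , X̂ , Ŷ , Z , (λ n → trans (sym (A≗A′ n)) (A≗ n)) , rest)
    }

  P⁺ : Problem
  P⁺ = record
    { dom = λ B → ∃[ C ] ∃[ Z ] B ≗ C ⊕ Z × Z ∈ dom P
    ; sol = λ B V → ∃[ C ] ∃[ Z ] ∃[ W ] B ≗ C ⊕ Z × V ≗ C ⊕ Z ⊕ W × W ∈ sol P Z
    ; dom-resp = λ B≗B′ (C , Z , B≗ , rest) →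
        C , Z , (λ n → trans (sym (B≗B′ n)) (B≗ n)) , rest
    ; sol-resp =
        (λ V≗V′ (C , Z , W , B≗ , V≗ , rest) →
          C , Z , W , B≗ , (λ n → trans (sym (V≗V′ n)) (V≗ n)) , rest) ,
        (λ B≗B′ (C , Z , W , B≗ , rest) →
          C , Z , W , (λ n → trans (sym (B≗B′ n)) (B≗ n)) , rest)
    }

  Q⁺≤Q : Q⁺ ≤c Q
  Q⁺≤Q A (X , X̂ , A≗X⊕X̂ , X̂∈Q , continue) =
    X̂ , X̂∈Q , ≤T-trans (≤T-⊕ʳ X X̂) X⊕X̂≤A , λ Ŷ Ŷ∈Q →
    let Z , Z-continues@(_ , Z≤X⊕Ŷ , _) = continue Ŷ Ŷ∈Q
    in X ⊕ Ŷ ⊕ Z , (X , X̂ , Ŷ , Z , A≗X⊕X̂ , (λ _ → refl) , Ŷ∈Q , Z-continues) ,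
       -- `Z` is computable from `X ⊕ Ŷ`, so adding it to the solution costs nothing.
       ≤T-trans (⊕-lub ≤T-refl Z≤X⊕Ŷ) (⊕-monoˡ Ŷ (≤T-trans (≤T-⊕ˡ X X̂) X⊕X̂≤A))
    where
    X⊕X̂≤A : X ⊕ X̂ ≤T A
    X⊕X̂≤A = ≤T-reflexive A≗X⊕X̂

  P⁺≤P : P⁺ ≤c P
  P⁺≤P B (C , Z , B≗C⊕Z , Z∈P) =
    Z , Z∈P , ≤T-trans (≤T-⊕ʳ C Z) C⊕Z≤B , λ W W∈P →
    C ⊕ Z ⊕ W , (C , Z , W , B≗C⊕Z , (λ _ → refl) , W∈P) , ⊕-monoˡ W C⊕Z≤B
    where
    C⊕Z≤B : C ⊕ Z ≤T B
    C⊕Z≤B = ≤T-reflexive B≗C⊕Z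

  R≤P⁺∘Q⁺ : R ComputablyReducibleTo Q FollowedBy P → R ≤c P⁺ ∘ₚ Q⁺
  R≤P⁺∘Q⁺ reduce X X∈R =
    let X̂ , X̂∈Q , X̂≤X , continue = reduce X X∈R
    in X ⊕ X̂ ,
       ((X , X̂ , (λ _ → refl) , X̂∈Q , continue) ,
        -- A `Q⁺`-solution is already presented as a join whose right part is a `P`-instance.
        λ { _ (X₁ , _ , Ŷ , Z , _ , B≗ , _ , Z∈P , _) → X₁ ⊕ Ŷ , Z , B≗ , Z∈P }) ,
       ⊕-lub ≤T-refl X̂≤X ,
       λ { V (B , (X₁ , X̂₁ , Ŷ , Z , X⊕X̂≗ , B≗ , _ , _ , _ , solve) ,
                  (C , Z₁ , W , B≗C⊕Z₁ , V≗ , W∈P)) →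
         -- `B` is split twice, once as a `Q⁺`-solution and once as a `P⁺`-instance; the splittings
         -- agree up to `≗`, so `W` solves `Z` as well as `Z₁`.
         let C⊕Z₁≗ : C ⊕ Z₁ ≗ X₁ ⊕ Ŷ ⊕ Z
             C⊕Z₁≗ n = trans (sym (B≗C⊕Z₁ n)) (B≗ n)
             Y , Y∈R , Y≤X₁⊕Ŷ⊕W =
               solve W (proj₂ (sol-resp P) (⊕-injectiveʳ C Z₁ (X₁ ⊕ Ŷ) Z C⊕Z₁≗) W∈P)
             X₁⊕Ŷ≤C : X₁ ⊕ Ŷ ≤T C
             X₁⊕Ŷ≤C = ≤T-reflexive (⊕-injectiveˡ C Z₁ (X₁ ⊕ Ŷ) Z C⊕Z₁≗)
             C⊕Z₁⊕W≤V : C ⊕ Z₁ ⊕ W ≤T V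
             C⊕Z₁⊕W≤V = ≤T-reflexive V≗
         in Y ,
            -- `Y` solves `X₁`, which agrees with `X` because both are left components of the same
            -- instance.
            proj₂ (sol-resp R) (λ n → sym (⊕-injectiveˡ X X̂ X₁ X̂₁ X⊕X̂≗ n)) Y∈R ,
            -- `V` contains `W` and, through `C`, also `X₁ ⊕ Ŷ`, so it suffices for computing `Y`.
            ≤T-trans Y≤X₁⊕Ŷ⊕W
              (≤T-trans (⊕-monoˡ W (≤T-trans X₁⊕Ŷ≤C (≤T-⊕ˡ C Z₁)))
                        (≤T-trans C⊕Z₁⊕W≤V (≤T-⊕ʳ X V))) }

proposition3p1 : (P Q R : Problem) → R ComputablyReducibleTo Q FollowedBy P ⇔ R ≤c∗ (P *c Q)
proposition3p1 P Q R = mk⇔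
  (λ reduce → P⁺ P Q R ∘ₚ Q⁺ P Q R ,
              (P⁺ P Q R , Q⁺ P Q R , P⁺≤P P Q R , Q⁺≤Q P Q R , refl) ,
              R≤P⁺∘Q⁺ P Q R reduce)
  (followedBy⇐ P Q R)
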